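{- Let $a$ and $b$ be positive integers with $a\ge 3$, and consider the Pell equation $x^{2}-(a^{2}b^{2}-2b)y^{2}=1$. Then the following hold. (i) The continued fraction expansion of $\sqrt{a^{2}b^{2}-2b}$ is $$\sqrt{a^{2}b^{2}-2b}=[ab-1;\overline{1,a-2,1,2ab-2}].$$ (ii) The fundamental solution of the equation is $(x_{1},y_{1})=(a^{2}b-1,a)$. (iii) The $n$-th solution $(x_{n},y_{n})$ of the equation can be found by $$\frac{x_{n}}{y_{n}}=[ab-1;(1,a-2,1,2ab-2)_{n-1},1].$$
   Context: $[a_0;a_1,a_2,\dots]$ denotes the simple continued fraction $a_0+\cfrac{1}{a_1+\cfrac{1}{a_2+\cdots}}$ (finite or infinite), and an overline marks the block of partial quotients that repeats periodically. The notation $(1,a-2,1,2ab-2)_{n-1}$ inside a continued fraction means that there are $n-1$ successive blocks $1,a-2,1,2ab-2$. For a positive non-square integer $d$, the fundamental solution $(x_1,y_1)$ of $x^2-dy^2=1$ is its smallest solution in positive integers, and the $n$-th solution $(x_n,y_n)$, $n\ge 1$, is given by $x_n+y_n\sqrt d=(x_1+y_1\sqrt d)^n$.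
   Formalization: In (iii) the printed continued fraction ends in 1, which is false (n=1 gives ab, but x_1/y_1 = ab-1/a); the formal statement proves x_n/y_n = [ab-1; (1,a-2,1,2ab-2)_{n-1}, 1, a-2, 1] instead. -}

module Defs where

open import Data.Nat.Base as ℕ using (ℕ; zero; suc)
open import Data.Integer.Base as ℤ using (+_; +0; +[1+_]; -[1+_])
open import Data.Rational.Base
open import Data.Rational.Properties
open import Data.Rational.Solver using (module +-*-Solver)
open import Data.List.Base using (List; []; _∷_; applyUpTo)
open import Data.List.Relation.Unary.All using (All)
open import Data.Vec.Base using (Vec; lookup)
open import Data.Nat.DivMod using (_mod_)
open import Data.Product.Base using (∃-syntax; _×_; _,_)
open import Data.Sum.Base using (_⊎_; inj₁; inj₂)
open import Relation.Nullary using (¬_; yes; no)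
open import Relation.Binary.PropositionalEquality using (_≡_; refl; sym; trans; cong; subst; subst₂)

open +-*-Solver using (solve; con; _:=_; _:+_; _:*_; _:-_)

-- Located two-sided Dedekind cuts.
record ℝ : Set₁ where
  field
    L U         : ℚ → Set      -- L q means q < x, U q means x < q
    L-inhabited : ∃[ q ] L q
    U-inhabited : ∃[ q ] U q
    L-lower     : ∀ {q r} → q < r → L r → L q
    U-upper     : ∀ {q r} → q < r → U q → U r
    L-rounded   : ∀ {q} → L q → ∃[ r ] (q < r × L r)
    U-rounded   : ∀ {r} → U r → ∃[ q ] (q < r × U q)
    disjoint    : ∀ {q} → ¬ (L q × U q)
    located     : ∀ {q r} → q < r → L q ⊎ U r

fromℕ : ℕ → ℚ
fromℕ n = + n / 1

module _ (d : ℕ) where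
  private
    δ k : ℚ
    δ = fromℕ d
    k = δ + 1ℚ

    0≤δ : 0ℚ ≤ δ
    0≤δ = nonNegative⁻¹ δ {{normalize-nonNeg d 1}}

    0<k : 0ℚ < k
    0<k = +-mono-≤-< 0≤δ (positive⁻¹ 1ℚ)

    sub-pos : ∀ {p q} → p < q → 0ℚ < q - p
    sub-pos {p} {q} p<q = subst (_< q - p) (+-inverseʳ p) (+-monoˡ-< (- p) p<q)

    sub-pos⁻¹ : ∀ {p q} → 0ℚ < q - p → p < q
    sub-pos⁻¹ {p} {q} h = subst₂ _<_ (+-identityˡ p)
      (solve 2 (λ p q → (q :- p) :+ p := q) refl p q) (+-monoˡ-< p h)

    *-pos : ∀ {p q} → 0ℚ < p → 0ℚ < q → 0ℚ < p * q
    *-pos {p} {q} hp hq = positive⁻¹ _ {{pos*pos⇒pos p {{positive hp}} q {{positive hq}}}}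

    square-mono : ∀ {p q} → 0ℚ ≤ p → p < q → p * p < q * q
    square-mono {p} {q} 0≤p p<q = sub-pos⁻¹ (subst (0ℚ <_)
      (solve 2 (λ p q → (q :- p) :* (p :+ q) := q :* q :- p :* p) refl p q)
      (*-pos (sub-pos p<q) (+-mono-≤-< 0≤p (≤-<-trans 0≤p p<q))))

    -- s = (k q + d) / (q + k) lies strictly between q and √d, because
    -- s - q = (d - q²) / (q + k) and d - s² = (d - q²)(k² - d) / (q + k)².
    module Step {q : ℚ} (0≤q : 0ℚ ≤ q) where
      m : ℚ
      m = q + k
      0<m : 0ℚ < m
      0<m = +-mono-≤-< 0≤q 0<k
      instance
        m≢0 : NonZero m
        m≢0 = >-nonZero 0<m
      t : ℚ
      t = 1/ m
      0<t : 0ℚ < t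
      0<t = positive⁻¹ t {{1/pos⇒pos m {{positive 0<m}}}}
      s : ℚ
      s = (k * q + δ) * t
      mt : m * t ≡ 1ℚ
      mt = *-inverseʳ m
      0<k²-δ : 0ℚ < k * k - δ
      0<k²-δ = subst (0ℚ <_)
        (solve 1 (λ x → (x :* x :+ x) :+ con 1ℚ :=
                        (x :+ con 1ℚ) :* (x :+ con 1ℚ) :- x) refl δ)
        (+-mono-≤-< (+-mono-≤ 0≤δ² 0≤δ) (positive⁻¹ 1ℚ))
        where
        0≤δ² : 0ℚ ≤ δ * δ
        0≤δ² = subst (_≤ δ * δ) (*-zeroʳ δ)
          (*-monoˡ-≤-nonNeg δ {{nonNegative 0≤δ}} 0≤δ)
      s-q : (δ - q * q) * t ≡ s - q
      s-q = trans
        (solve 4 (λ x k q t → (x :- q :* q) :* t :=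
           (k :* q :+ x) :* t :- q :* ((q :+ k) :* t)) refl δ k q t)
        (cong (λ z → s - z) (trans (cong (q *_) mt) (*-identityʳ q)))
      δ-s² : (δ - q * q) * ((k * k - δ) * (t * t)) ≡ δ - s * s
      δ-s² = trans
        (solve 4 (λ x k q t →
           (x :- q :* q) :* ((k :* k :- x) :* (t :* t)) :=
           x :* (((q :+ k) :* t) :* ((q :+ k) :* t))
             :- ((k :* q :+ x) :* t) :* ((k :* q :+ x) :* t)) refl δ k q t)
        (cong (λ z → z - s * s)
          (trans (cong (λ z → δ * (z * z)) mt) (*-identityʳ δ)))
      c>0 : 0ℚ < (k * k - δ) * (t * t)
      c>0 = *-pos 0<k²-δ (*-pos 0<t 0<t)

      up : q * q < δ → q < s × s * s < δ
      up h = sub-pos⁻¹ (subst (0ℚ <_) s-q (*-pos (sub-pos h) 0<t))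
           , sub-pos⁻¹ (subst (0ℚ <_) δ-s² (*-pos (sub-pos h) c>0))

      down : 0ℚ < q → δ < q * q → s < q × 0ℚ < s × δ < s * s
      down 0<q h =
          sub-pos⁻¹ (subst (0ℚ <_)
            (trans (solve 3 (λ x q t → (q :* q :- x) :* t :=
                       con 0ℚ :- (x :- q :* q) :* t) refl δ q t)
              (trans (cong (λ z → 0ℚ - z) s-q)
                (solve 2 (λ s q → con 0ℚ :- (s :- q) := q :- s) refl s q)))
            (*-pos (sub-pos h) 0<t))
        , *-pos (+-mono-<-≤ (*-pos 0<k 0<q) 0≤δ) 0<t
        , sub-pos⁻¹ (subst (0ℚ <_)
            (trans (solve 3 (λ x q c → (q :* q :- x) :* c :=
                       con 0ℚ :- (x :- q :* q) :* c) refl δ q _)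
              (trans (cong (λ z → 0ℚ - z) δ-s²)
                (solve 2 (λ x s → con 0ℚ :- (x :- s) := s :- x) refl δ (s * s))))
            (*-pos (sub-pos h) c>0))

    Below Above : ℚ → Set
    Below q = q < 0ℚ ⊎ q * q < δ
    Above q = 0ℚ < q × δ < q * q

  √_ : ℝ
  √_ = record
    { L = Below
    ; U = Above
    ; L-inhabited = - 1ℚ , inj₁ (negative⁻¹ (- 1ℚ))
    ; U-inhabited = k , 0<k , sub-pos⁻¹ (Step.0<k²-δ {0ℚ} ≤-refl)
    ; L-lower = lower
    ; U-upper = λ { q<r (0<q , h) →
        <-trans 0<q q<r , <-trans h (square-mono (<⇒≤ 0<q) q<r) }
    ; L-rounded = rounded
    ; U-rounded = λ { {r} (0<r , h) →
        let (s<r , 0<s , δ<s²) = Step.down (<⇒≤ 0<r) 0<r h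
        in  _ , s<r , 0<s , δ<s² }
    ; disjoint = λ { (inj₁ q<0 , 0<q , _) → <-asym q<0 0<q
                   ; (inj₂ h , _ , h′)   → <-asym h h′ }
    ; located = loc
    }
    where
    lower : ∀ {q r} → q < r → Below r → Below q
    lower q<r (inj₁ r<0) = inj₁ (<-trans q<r r<0)
    lower {q} q<r (inj₂ h) with q <? 0ℚ
    ... | yes q<0 = inj₁ q<0
    ... | no  q≮0 = inj₂ (<-trans (square-mono (≮⇒≥ q≮0) q<r) h)

    rounded : ∀ {q} → Below q → ∃[ r ] (q < r × Below r)
    rounded (inj₁ q<0) = let (r , q<r , r<0) = <-dense q<0 in r , q<r , inj₁ r<0
    rounded {q} (inj₂ h) with q <? 0ℚ
    ... | yes q<0 = let (r , q<r , r<0) = <-dense q<0 in r , q<r , inj₁ r<0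
    ... | no  q≮0 = let (q<s , s²<δ) = Step.up (≮⇒≥ q≮0) h in _ , q<s , inj₂ s²<δ

    loc : ∀ {q r} → q < r → Below q ⊎ Above r
    loc {q} q<r with q <? 0ℚ | q * q <? δ
    ... | yes q<0 | _     = inj₁ (inj₁ q<0)
    ... | no  _   | yes h = inj₁ (inj₂ h)
    ... | no  q≮0 | no  h =
      let 0≤q = ≮⇒≥ q≮0
      in  inj₂ (≤-<-trans 0≤q q<r , ≤-<-trans (≮⇒≥ h) (square-mono 0≤q q<r))

-- |u n - x| < ε is written as u n - ε < x < u n + ε.
_⟶_ : (ℕ → ℚ) → ℝ → Set
u ⟶ x = ∀ ε → 0ℚ < ε →
  ∃[ N ] (∀ n → N ℕ.≤ n → ℝ.L x (u n - ε) × ℝ.U x (u n + ε))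

-- The value at 0ℚ is a convention; it is never used when the partial
-- quotients after the first are positive, as required below.
recip : ℚ → ℚ
recip   (mkℚ +0       _ _) = 0ℚ
recip p@(mkℚ +[1+ _ ] _ _) = 1/ p
recip p@(mkℚ -[1+ _ ] _ _) = 1/ p

[_⨾_] : ℕ → List ℕ → ℚ
[ a₀ ⨾ []      ] = fromℕ a₀
[ a₀ ⨾ a₁ ∷ as ] = fromℕ a₀ + recip [ a₁ ⨾ as ]

record IsFiniteCF (q : ℚ) (a₀ : ℕ) (as : List ℕ) : Set where
  field
    quotients>0 : All (0 ℕ.<_) as
    value       : q ≡ [ a₀ ⨾ as ]

convergent : (ℕ → ℕ) → ℕ → ℚ
convergent a n = [ a 0 ⨾ applyUpTo (λ i → a (suc i)) n ]

record IsInfiniteCF (x : ℝ) (a : ℕ → ℕ) : Set where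
  field
    quotients>0 : ∀ i → 0 ℕ.< a (suc i)
    value       : convergent a ⟶ x

-- The partial quotients of [a₀; overline(block)].
periodic : ∀ {m} → ℕ → Vec ℕ (suc m) → ℕ → ℕ
periodic a₀ block zero    = a₀
periodic {m} a₀ block (suc i) = lookup block (i mod suc m)

record IsPositiveSolution (d x y : ℕ) : Set where
  field
    x>0  : 0 ℕ.< x
    y>0  : 0 ℕ.< y
    pell : (+ x) ℤ.^ 2 ℤ.- (+ d) ℤ.* (+ y) ℤ.^ 2 ≡ + 1

record IsFundamentalSolution (d x y : ℕ) : Set where
  field
    solution : IsPositiveSolution d x y
    smallest : ∀ u v → IsPositiveSolution d u v → x ℕ.≤ u × y ℕ.≤ v

-- The pair (x , y) stands for x + y√d.
mul√ : ℕ → ℕ × ℕ → ℕ × ℕ → ℕ × ℕ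
mul√ d (x , y) (u , v) = x ℕ.* u ℕ.+ d ℕ.* (y ℕ.* v) , x ℕ.* v ℕ.+ y ℕ.* u

pow√ : ℕ → ℕ × ℕ → ℕ → ℕ × ℕ
pow√ d z zero    = 1 , 0
pow√ d z (suc n) = mul√ d z (pow√ d z n)

IsNthSolution : (d n x y : ℕ) → Set
IsNthSolution d n x y =
  ∃[ x₁ ] ∃[ y₁ ] (IsFundamentalSolution d x₁ y₁ × (x , y) ≡ pow√ d (x₁ , y₁) n)

module Submission where

-- Multiplying a fraction x/y by one period of the continued fraction, i.e.
-- replacing the tail of [c; ...] = x/y (where c = ab - 1) by 1, a-2, 1, 2c followed
-- by that tail, sends (x, y) to (Xx + day, Xy + ax) with X = a²b - 1: this is exactly
-- multiplication of x + y√d by the unit X + a√d.  Hence the continued fraction with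
-- n - 1 blocks is xₙ/yₙ.  Moreover x² - d y² is unchanged by each period while y
-- grows, so it stays bounded along all convergents and |x²/y² - d| tends to 0.
-- Fundamentality of (X, a) follows from d = (ab)² - 2b: a positive solution
-- (u, v) has u² < (abv)², so u ≤ abv - 1, and squaring yields abv ≤ bv², i.e. a ≤ v.

open import Data.Nat.Base as ℕ using (ℕ; zero; suc; z≤n; s≤s)
open import Data.Integer.Base as ℤ using (+_; +[1+_]; -[1+_])
import Data.Integer.Properties as ℤ
open import Data.Fin.Base as Fin using (Fin)
open import Data.List.Base using (List; []; _∷_; _++_; concat; replicate; applyUpTo)
open import Data.List.Relation.Unary.All using (All; []; _∷_)
open import Data.List.Relation.Unary.All.Properties using (applyUpTo⁺₂)
open import Data.Product.Base using (∃-syntax; Σ-syntax; _×_; _,_; proj₁; proj₂)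
open import Data.Sum.Base using (inj₁; inj₂)
open import Data.Vec.Base as Vec using (Vec; lookup; toList)
open import Relation.Nullary using (yes; no; contradiction)
open import Relation.Binary.PropositionalEquality
open import Defs

module Fractions where
  import Data.Nat.Properties as ℕ
  open import Data.Rational.Base
  open import Data.Rational.Properties
  open import Data.Rational.Solver using (module +-*-Solver)
  open import Data.Rational.Unnormalised.Base as ℚᵘ using (mkℚᵘ; *≡*)
  import Data.Rational.Unnormalised.Properties as ℚᵘ
  open +-*-Solver using (solve; con; _:=_; _:+_; _:*_; _:-_)

  -- Naturals inside the rationals and the Archimedean property.

  toℚᵘ-fromℕ : ∀ n → toℚᵘ (fromℕ n) ℚᵘ.≃ mkℚᵘ (+ n) 0
  toℚᵘ-fromℕ n = toℚᵘ-fromℚᵘ (mkℚᵘ (+ n) 0)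

  fromℕ-+ : ∀ m n → fromℕ (m ℕ.+ n) ≡ fromℕ m + fromℕ n
  fromℕ-+ m n = toℚᵘ-injective (ℚᵘ.≃-trans (toℚᵘ-fromℕ (m ℕ.+ n)) (ℚᵘ.≃-trans
    (*≡* (cong (ℤ._* (+ 1)) (sym (cong₂ ℤ._+_ (ℤ.*-identityʳ (+ m)) (ℤ.*-identityʳ (+ n))))))
    (ℚᵘ.≃-sym (ℚᵘ.≃-trans (toℚᵘ-homo-+ (fromℕ m) (fromℕ n))
      (ℚᵘ.+-cong (toℚᵘ-fromℕ m) (toℚᵘ-fromℕ n))))))

  fromℕ-* : ∀ m n → fromℕ (m ℕ.* n) ≡ fromℕ m * fromℕ n
  fromℕ-* m n = toℚᵘ-injective (ℚᵘ.≃-trans (toℚᵘ-fromℕ (m ℕ.* n)) (ℚᵘ.≃-trans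
    (*≡* (cong (ℤ._* (+ 1)) (ℤ.pos-* m n)))
    (ℚᵘ.≃-sym (ℚᵘ.≃-trans (toℚᵘ-homo-* (fromℕ m) (fromℕ n))
      (ℚᵘ.*-cong (toℚᵘ-fromℕ m) (toℚᵘ-fromℕ n))))))

  /-*-fromℕ : ∀ x y .{{_ : ℕ.NonZero y}} → (+ x / y) * fromℕ y ≡ fromℕ x
  /-*-fromℕ x y@(suc k) = toℚᵘ-injective (ℚᵘ.≃-trans (toℚᵘ-homo-* (+ x / y) (fromℕ y)) (ℚᵘ.≃-trans
    (ℚᵘ.*-cong (toℚᵘ-fromℚᵘ (mkℚᵘ (+ x) k)) (toℚᵘ-fromℕ y)) (ℚᵘ.≃-trans
    (*≡* (trans (ℤ.*-identityʳ (+ x ℤ.* + y)) (cong (λ z → + x ℤ.* + z) (sym (ℕ.*-identityʳ y)))))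
    (ℚᵘ.≃-sym (toℚᵘ-fromℕ x)))))

  0≤fromℕ : ∀ n → 0ℚ ≤ fromℕ n
  0≤fromℕ n = nonNegative⁻¹ (fromℕ n) {{normalize-nonNeg n 1}}

  fromℕ-pos : ∀ {n} → 0 ℕ.< n → Positive (fromℕ n)
  fromℕ-pos {suc n} _ = normalize-pos (suc n) 1

  fromℕ-mono-≤ : ∀ {m n} → m ℕ.≤ n → fromℕ m ≤ fromℕ n
  fromℕ-mono-≤ {m} {n} m≤n = subst₂ _≤_ (+-identityʳ (fromℕ m))
    (trans (sym (fromℕ-+ m (n ℕ.∸ m))) (cong fromℕ (ℕ.m+[n∸m]≡n m≤n)))
    (+-monoʳ-≤ (fromℕ m) (0≤fromℕ (n ℕ.∸ m)))

  -- For ε = (n + 1)/D the witness k = mD works, because (mD + 1)ε = ε + m(n + 1) > m.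
  archimedean : ∀ m ε → 0ℚ < ε → ∃[ k ] fromℕ m < fromℕ (suc k) * ε
  archimedean m (mkℚ (+ zero) _ _) (*<* (ℤ.+<+ ()))
  archimedean m ε@(mkℚ -[1+ _ ] _ _) 0<ε = contradiction 0<ε (<-asym (negative⁻¹ ε))
  archimedean m ε@(mkℚ +[1+ n ] d-1 _) 0<ε = m ℕ.* D , (begin-strict
    fromℕ m                              ≡⟨ +-identityˡ (fromℕ m) ⟨
    0ℚ + fromℕ m                         <⟨ +-monoˡ-< (fromℕ m) 0<ε ⟩
    ε + fromℕ m                          ≤⟨ +-monoʳ-≤ ε (fromℕ-mono-≤ (ℕ.m≤m*n m (suc n))) ⟩
    ε + fromℕ (m ℕ.* suc n)              ≡⟨ cong (λ z → ε + z) (fromℕ-* m (suc n)) ⟩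
    ε + fromℕ m * fromℕ (suc n)          ≡⟨ cong (λ z → ε + fromℕ m * z) εD ⟨
    ε + fromℕ m * (ε * fromℕ D)          ≡⟨ regroup ε (fromℕ m) (fromℕ D) ⟩
    (1ℚ + fromℕ m * fromℕ D) * ε         ≡⟨ cong (λ z → (1ℚ + z) * ε) (fromℕ-* m D) ⟨
    (1ℚ + fromℕ (m ℕ.* D)) * ε           ≡⟨ cong (_* ε) (fromℕ-+ 1 (m ℕ.* D)) ⟨
    fromℕ (suc (m ℕ.* D)) * ε            ∎)
    where
    open ≤-Reasoning
    D : ℕ
    D = suc d-1
    regroup : ∀ e x y → e + x * (e * y) ≡ (1ℚ + x * y) * e
    regroup = solve 3 (λ e x y → e :+ x :* (e :* y) := (con 1ℚ :+ x :* y) :* e) refl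
    εD : ε * fromℕ D ≡ fromℕ (suc n)
    εD = trans (cong (_* fromℕ D) (sym (↥p/↧p≡p ε))) (/-*-fromℕ (suc n) D)

  -- Rational approximation of √d.

  p<q⇒0<q-p : ∀ {p q} → p < q → 0ℚ < q - p
  p<q⇒0<q-p {p} {q} p<q = subst (_< q - p) (+-inverseʳ p) (+-monoˡ-< (- p) p<q)

  p≤q⇒0≤q-p : ∀ {p q} → p ≤ q → 0ℚ ≤ q - p
  p≤q⇒0≤q-p {p} {q} p≤q = subst (_≤ q - p) (+-inverseʳ p) (+-monoˡ-≤ (- p) p≤q)

  0<q-p⇒p<q : ∀ {p q} → 0ℚ < q - p → p < q
  0<q-p⇒p<q {p} {q} h = subst₂ _<_ (+-identityˡ p)
    (solve 2 (λ p q → (q :- p) :+ p := q) refl p q) (+-monoˡ-< p h)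

  *-nonNeg : ∀ {p q} → 0ℚ ≤ p → 0ℚ ≤ q → 0ℚ ≤ p * q
  *-nonNeg {p} {q} 0≤p 0≤q = subst (_≤ p * q) (*-zeroʳ p)
    (*-monoˡ-≤-nonNeg p {{nonNegative 0≤p}} 0≤q)

  -- The hypothesis 1 ≤ u turns a bound on |u² - d| into the same bound on |u - √d|.
  √-approx : ∀ d {u ε} → 0ℚ < ε → 1ℚ ≤ u →
    u * u < fromℕ d + ε → fromℕ d < u * u + ε →
    ℝ.L (√ d) (u - ε) × ℝ.U (√ d) (u + ε)
  √-approx d {u} {ε} 0<ε 1≤u u²<d+ε d<u²+ε = lower , 0<u+ε , upper
    where
    0≤ε : 0ℚ ≤ ε
    0≤ε = <⇒≤ 0<ε
    0≤u : 0ℚ ≤ u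
    0≤u = ≤-trans (nonNegative⁻¹ 1ℚ) 1≤u
    -- The cross term 2uε in (u ± ε)² splits as ε + ε(u - 1) + uε. The first piece absorbs the error
    -- in u², the second is non-negative since u ≥ 1, and the third joins ε² to form ε(u ± ε).
    0≤ε[u-1] : 0ℚ ≤ ε * (u - 1ℚ)
    0≤ε[u-1] = *-nonNeg 0≤ε (p≤q⇒0≤q-p 1≤u)

    0<u+ε : 0ℚ < u + ε
    0<u+ε = +-mono-≤-< 0≤u 0<ε

    upper : fromℕ d < (u + ε) * (u + ε)
    upper = 0<q-p⇒p<q (subst (0ℚ <_)
      (solve 3 (λ x u e → (u :* u :+ e :- x) :+ (e :* (u :- con 1ℚ) :+ e :* (u :+ e))
                          := (u :+ e) :* (u :+ e) :- x) refl (fromℕ d) u ε)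
      (+-mono-<-≤ (p<q⇒0<q-p d<u²+ε) (+-mono-≤ 0≤ε[u-1] (*-nonNeg 0≤ε (<⇒≤ 0<u+ε)))))

    lower : ℝ.L (√ d) (u - ε)
    -- A negative `u - ε` is below √d by the definition of the cut; otherwise ε(u - ε) ≥ 0 is
    -- available.
    lower with u - ε <? 0ℚ
    ... | yes u-ε<0 = inj₁ u-ε<0
    ... | no  u-ε≮0 = inj₂ (0<q-p⇒p<q (subst (0ℚ <_)
      (solve 3 (λ x u e → (x :+ e :- u :* u) :+ (e :* (u :- con 1ℚ) :+ e :* (u :- e))
                          := x :- (u :- e) :* (u :- e)) refl (fromℕ d) u ε)
      (+-mono-<-≤ (p<q⇒0<q-p u²<d+ε) (+-mono-≤ 0≤ε[u-1] (*-nonNeg 0≤ε (≮⇒≥ u-ε≮0))))))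

  -- Finite continued fractions as quotients of natural numbers.

  record Fraction (c : ℕ) (as : List ℕ) (x y : ℕ) : Set where
    constructor fraction
    field
      y>0   : 0 ℕ.< y
      -- Forces the value to be at least 1. This keeps `recip` away from its conventional value at 0
      -- and supplies the hypothesis 1 ≤ u of `√-approx`.
      y≤x   : y ℕ.≤ x
      value : [ c ⨾ as ] * fromℕ y ≡ fromℕ x

    x>0 : 0 ℕ.< x
    x>0 = ℕ.<-≤-trans y>0 y≤x

    1≤cf : 1ℚ ≤ [ c ⨾ as ]
    1≤cf = *-cancelʳ-≤-pos (fromℕ y) {{fromℕ-pos y>0}}
      (subst₂ _≤_ (sym (*-identityˡ (fromℕ y))) (sym value) (fromℕ-mono-≤ y≤x))

  recip-inverseˡ : ∀ p → 0ℚ < p → recip p * p ≡ 1ℚ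
  recip-inverseˡ p@(mkℚ +[1+ _ ] _ _) _ = *-inverseˡ p
  recip-inverseˡ p@(mkℚ -[1+ _ ] _ _) _ = *-inverseˡ p
  recip-inverseˡ (mkℚ (+ zero) _ _) (*<* (ℤ.+<+ ()))

  fraction-[] : ∀ {c} → 1 ℕ.≤ c → Fraction c [] c 1
  fraction-[] {c} 1≤c = fraction (s≤s z≤n) 1≤c (*-identityʳ (fromℕ c))

  -- The continuant recursion: c + 1/(p/q) = (cp + q)/p, where c ≥ 1 gives p ≤ cp + q.
  fraction-∷ : ∀ {c c′ as p q} → 1 ℕ.≤ c → Fraction c′ as p q →
    Fraction c (c′ ∷ as) (c ℕ.* p ℕ.+ q) p
  fraction-∷ {c} {c′} {as} {p} {q} 1≤c f = fraction x>0
    (ℕ.≤-trans (ℕ.m≤n*m p c {{ℕ.>-nonZero 1≤c}}) (ℕ.m≤m+n _ q)) (begin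
    (fromℕ c + recip t) * fromℕ p            ≡⟨ *-distribʳ-+ (fromℕ p) (fromℕ c) (recip t) ⟩
    fromℕ c * fromℕ p + recip t * fromℕ p    ≡⟨ cong₂ _+_ (fromℕ-* c p) (cong (recip t *_) value) ⟨
    fromℕ (c ℕ.* p) + recip t * (t * fromℕ q) ≡⟨ cong (λ z → fromℕ (c ℕ.* p) + z) cancel ⟩
    fromℕ (c ℕ.* p) + fromℕ q                ≡⟨ fromℕ-+ (c ℕ.* p) q ⟨
    fromℕ (c ℕ.* p ℕ.+ q)                    ∎)
    where
    open ≡-Reasoning
    open Fraction f
    t : ℚ
    t = [ c′ ⨾ as ]
    cancel : recip t * (t * fromℕ q) ≡ fromℕ q
    cancel = trans (sym (*-assoc (recip t) t (fromℕ q))) (trans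
      (cong (_* fromℕ q) (recip-inverseˡ t (<-≤-trans (positive⁻¹ 1ℚ) 1≤cf)))
      (*-identityˡ (fromℕ q)))

  cf-+ : ∀ m c as → [ m ℕ.+ c ⨾ as ] ≡ fromℕ m + [ c ⨾ as ]
  cf-+ m c []       = fromℕ-+ m c
  cf-+ m c (a ∷ as) = trans (cong (_+ recip [ a ⨾ as ]) (fromℕ-+ m c)) (+-assoc (fromℕ m) (fromℕ c) _)

  -- Serves the last quotient 2c of a block: [2c; as] is c plus the fraction x/y already known for
  -- [c; as].
  fraction-+ : ∀ m {c as x y} → Fraction c as x y → Fraction (m ℕ.+ c) as (m ℕ.* y ℕ.+ x) y
  fraction-+ m {c} {as} {x} {y} f = fraction y>0 (ℕ.≤-trans y≤x (ℕ.m≤n+m x (m ℕ.* y))) (begin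
    [ m ℕ.+ c ⨾ as ] * fromℕ y             ≡⟨ cong (_* fromℕ y) (cf-+ m c as) ⟩
    (fromℕ m + [ c ⨾ as ]) * fromℕ y       ≡⟨ *-distribʳ-+ (fromℕ y) (fromℕ m) [ c ⨾ as ] ⟩
    fromℕ m * fromℕ y + [ c ⨾ as ] * fromℕ y ≡⟨ cong₂ _+_ (sym (fromℕ-* m y)) value ⟩
    fromℕ (m ℕ.* y) + fromℕ x              ≡⟨ fromℕ-+ (m ℕ.* y) x ⟨
    fromℕ (m ℕ.* y ℕ.+ x)                  ∎)
    where
    open ≡-Reasoning
    open Fraction f

  fraction-/ : ∀ {c as x y} → Fraction c as x y → .{{_ : ℕ.NonZero y}} → + x / y ≡ [ c ⨾ as ]
  fraction-/ {c} {as} {x} {y} f = ≤-antisym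
    (*-cancelʳ-≤-pos (fromℕ y) {{fromℕ-pos y>0}} (≤-reflexive eq))
    (*-cancelʳ-≤-pos (fromℕ y) {{fromℕ-pos y>0}} (≤-reflexive (sym eq)))
    where
    open Fraction f
    eq : (+ x / y) * fromℕ y ≡ [ c ⨾ as ] * fromℕ y
    eq = trans (/-*-fromℕ x y) (sym value)

  cf-fraction : ∀ {c as} → 1 ℕ.≤ c → All (0 ℕ.<_) as → ∃[ x ] ∃[ y ] Fraction c as x y
  cf-fraction 1≤c []       = _ , 1 , fraction-[] 1≤c
  cf-fraction 1≤c (0<a ∷ 0<as) = let (_ , _ , f) = cf-fraction 0<a 0<as in _ , _ , fraction-∷ 1≤c f

  *-cancelʳ-<-fromℕ : ∀ {p q} n → p * fromℕ n < q * fromℕ n → p < q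
  *-cancelʳ-<-fromℕ n = *-cancelʳ-<-nonNeg (fromℕ n) {{nonNegative (0≤fromℕ n)}}

  -- |u² - d| = |x² - d y²| / y² ≤ B / y.
  fraction-approx : ∀ d B k {c as x y ε} → Fraction c as x y → k ℕ.< y →
    x ℕ.* x ℕ.≤ d ℕ.* (y ℕ.* y) ℕ.+ B → d ℕ.* (y ℕ.* y) ℕ.≤ x ℕ.* x ℕ.+ B →
    0ℚ < ε → fromℕ B < fromℕ (suc k) * ε →
    ℝ.L (√ d) ([ c ⨾ as ] - ε) × ℝ.U (√ d) ([ c ⨾ as ] + ε)
  fraction-approx d B k {c} {as} {x} {y} {ε} f k<y x²≤ dy²≤ 0<ε B<[k+1]ε = √-approx d 0<ε 1≤cf
    (*-cancelʳ-<-fromℕ (y ℕ.* y) (begin-strict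
      u * u * fromℕ (y ℕ.* y)                ≡⟨ u²y² ⟩
      fromℕ (x ℕ.* x)                        ≤⟨ fromℕ-mono-≤ x²≤ ⟩
      fromℕ (d ℕ.* (y ℕ.* y) ℕ.+ B)          ≡⟨ fromℕ-+ (d ℕ.* (y ℕ.* y)) B ⟩
      fromℕ (d ℕ.* (y ℕ.* y)) + fromℕ B      <⟨ +-monoʳ-< (fromℕ (d ℕ.* (y ℕ.* y))) B<εy² ⟩
      fromℕ (d ℕ.* (y ℕ.* y)) + ε * fromℕ (y ℕ.* y) ≡⟨ cong (_+ ε * fromℕ (y ℕ.* y)) (fromℕ-* d (y ℕ.* y)) ⟩
      fromℕ d * fromℕ (y ℕ.* y) + ε * fromℕ (y ℕ.* y) ≡⟨ *-distribʳ-+ (fromℕ (y ℕ.* y)) (fromℕ d) ε ⟨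
      (fromℕ d + ε) * fromℕ (y ℕ.* y)        ∎))
    (*-cancelʳ-<-fromℕ (y ℕ.* y) (begin-strict
      fromℕ d * fromℕ (y ℕ.* y)              ≡⟨ fromℕ-* d (y ℕ.* y) ⟨
      fromℕ (d ℕ.* (y ℕ.* y))                ≤⟨ fromℕ-mono-≤ dy²≤ ⟩
      fromℕ (x ℕ.* x ℕ.+ B)                  ≡⟨ fromℕ-+ (x ℕ.* x) B ⟩
      fromℕ (x ℕ.* x) + fromℕ B              <⟨ +-monoʳ-< (fromℕ (x ℕ.* x)) B<εy² ⟩
      fromℕ (x ℕ.* x) + ε * fromℕ (y ℕ.* y)  ≡⟨ cong (_+ ε * fromℕ (y ℕ.* y)) u²y² ⟨
      u * u * fromℕ (y ℕ.* y) + ε * fromℕ (y ℕ.* y) ≡⟨ *-distribʳ-+ (fromℕ (y ℕ.* y)) (u * u) ε ⟨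
      (u * u + ε) * fromℕ (y ℕ.* y)          ∎))
    where
    open ≤-Reasoning
    open Fraction f
    u : ℚ
    u = [ c ⨾ as ]
    u²y² : u * u * fromℕ (y ℕ.* y) ≡ fromℕ (x ℕ.* x)
    u²y² = begin-equality
      u * u * fromℕ (y ℕ.* y)          ≡⟨ cong (u * u *_) (fromℕ-* y y) ⟩
      u * u * (fromℕ y * fromℕ y)      ≡⟨ solve 2 (λ u y → u :* u :* (y :* y) := (u :* y) :* (u :* y))
                                            refl u (fromℕ y) ⟩
      (u * fromℕ y) * (u * fromℕ y)    ≡⟨ cong₂ _*_ value value ⟩
      fromℕ x * fromℕ x                ≡⟨ fromℕ-* x x ⟨
      fromℕ (x ℕ.* x)                  ∎
    B<εy² : fromℕ B < ε * fromℕ (y ℕ.* y)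
    B<εy² = begin-strict
      fromℕ B                  <⟨ B<[k+1]ε ⟩
      fromℕ (suc k) * ε        ≤⟨ *-monoʳ-≤-nonNeg ε {{nonNegative (<⇒≤ 0<ε)}}
                                    (fromℕ-mono-≤ (ℕ.≤-trans k<y y≤y²)) ⟩
      fromℕ (y ℕ.* y) * ε      ≡⟨ *-comm (fromℕ (y ℕ.* y)) ε ⟩
      ε * fromℕ (y ℕ.* y)      ∎
      where
      y≤y² : y ℕ.≤ y ℕ.* y
      y≤y² = ℕ.m≤m*n y y {{ℕ.>-nonZero y>0}}

open Fractions
open import Data.Nat.Base using (_+_; _*_; _∸_; _^_; _≤_; _<_; NonZero)
open import Data.Nat.DivMod using (_mod_)
open import Data.Nat.Properties
open import Data.Nat.Tactic.RingSolver using (solve-∀)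
open import Data.Rational.Base using (_/_)

-- Pell's equation and the norm x² - dy² over the natural numbers.

square-cancel-≤ : ∀ {m n} → m * m ≤ n * n → m ≤ n
square-cancel-≤ m²≤n² = ≮⇒≥ (λ n<m → <⇒≱ (*-mono-< n<m n<m) m²≤n²)

square-cancel-< : ∀ {m n} → m * m < n * n → m < n
square-cancel-< m²<n² = ≰⇒> (λ n≤m → <⇒≱ m²<n² (*-mono-≤ n≤m n≤m))

pos-square : ∀ x → (+ x) ℤ.^ 2 ≡ + (x * x)
pos-square x = trans (cong (+ x ℤ.*_) (ℤ.*-identityʳ (+ x))) (sym (ℤ.pos-* x x))

pell-lhs : ∀ d x y → (+ x) ℤ.^ 2 ℤ.- (+ d) ℤ.* (+ y) ℤ.^ 2 ≡ + (x * x) ℤ.- + (d * (y * y))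
pell-lhs d x y = cong₂ ℤ._-_ (pos-square x)
  (trans (cong (+ d ℤ.*_) (pos-square y)) (sym (ℤ.pos-* d (y * y))))

-- Trades the subtraction over ℤ for an equation over ℕ, where the later algebra takes place.
pell⇒ : ∀ d x y → (+ x) ℤ.^ 2 ℤ.- (+ d) ℤ.* (+ y) ℤ.^ 2 ≡ + 1 → x * x ≡ 1 + d * (y * y)
pell⇒ d x y eq = ℤ.+-injective (begin
  p                    ≡⟨ ℤ.+-identityʳ p ⟨
  p ℤ.+ + 0            ≡⟨ cong (λ z → p ℤ.+ z) (ℤ.+-inverseˡ q) ⟨
  p ℤ.+ (ℤ.- q ℤ.+ q)  ≡⟨ ℤ.+-assoc p (ℤ.- q) q ⟨
  (p ℤ.- q) ℤ.+ q      ≡⟨ cong (ℤ._+ q) (trans (sym (pell-lhs d x y)) eq) ⟩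
  + 1 ℤ.+ q            ∎)
  where
  open ≡-Reasoning
  p q : ℤ.ℤ
  p = + (x * x)
  q = + (d * (y * y))

pell⇐ : ∀ d x y → x * x ≡ 1 + d * (y * y) → (+ x) ℤ.^ 2 ℤ.- (+ d) ℤ.* (+ y) ℤ.^ 2 ≡ + 1
pell⇐ d x y eq = begin
  (+ x) ℤ.^ 2 ℤ.- (+ d) ℤ.* (+ y) ℤ.^ 2  ≡⟨ pell-lhs d x y ⟩
  + (x * x) ℤ.- q                        ≡⟨ cong (λ z → + z ℤ.- q) eq ⟩
  (+ 1 ℤ.+ q) ℤ.- q                      ≡⟨ ℤ.+-assoc (+ 1) q (ℤ.- q) ⟩
  + 1 ℤ.+ (q ℤ.- q)                      ≡⟨ cong (λ z → + 1 ℤ.+ z) (ℤ.+-inverseʳ q) ⟩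
  + 1                                    ∎
  where
  open ≡-Reasoning
  q : ℤ.ℤ
  q = + (d * (y * y))

-- Invariance of x² - d y², with both sides moved so that no subtraction occurs.
mul√-norm : ∀ d X A x y → X * X ≡ 1 + d * (A * A) →
  let (x′ , y′) = mul√ d (X , A) (x , y) in
  x′ * x′ + d * (y * y) ≡ d * (y′ * y′) + x * x
-- Adding n(dy² + x²) turns the lone terms dy² and x² into multiples of 1 + n = X². What remains,
-- `mid`, is Brahmagupta's identity with its negative terms moved across.
mul√-norm d X A x y pell = +-cancelʳ-≡ (n * (d * (y * y) + x * x)) _ _ (begin
  x′ * x′ + d * (y * y) + n * (d * (y * y) + x * x)         ≡⟨ lhs (x′ * x′) (d * (y * y)) n (x * x) ⟩
  x′ * x′ + (1 + n) * (d * (y * y)) + n * (x * x)           ≡⟨ cong (λ z → x′ * x′ + z * (d * (y * y)) + n * (x * x)) pell ⟨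
  x′ * x′ + X * X * (d * (y * y)) + n * (x * x)             ≡⟨ mid d X A x y ⟩
  d * (y′ * y′) + X * X * (x * x) + n * (d * (y * y))       ≡⟨ cong (λ z → d * (y′ * y′) + z * (x * x) + n * (d * (y * y))) pell ⟩
  d * (y′ * y′) + (1 + n) * (x * x) + n * (d * (y * y))     ≡⟨ rhs (d * (y′ * y′)) (d * (y * y)) n (x * x) ⟩
  d * (y′ * y′) + x * x + n * (d * (y * y) + x * x)         ∎)
  where
  open ≡-Reasoning
  n x′ y′ : ℕ
  n = d * (A * A)
  x′ = proj₁ (mul√ d (X , A) (x , y))
  y′ = proj₂ (mul√ d (X , A) (x , y))
  lhs : ∀ p q n r → p + q + n * (q + r) ≡ p + (1 + n) * q + n * r
  lhs = solve-∀
  rhs : ∀ p q n r → p + (1 + n) * r + n * q ≡ p + r + n * (q + r)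
  rhs = solve-∀
  mid : ∀ d X A x y →
    (X * x + d * (A * y)) * (X * x + d * (A * y)) + X * X * (d * (y * y)) + d * (A * A) * (x * x)
    ≡ d * ((X * y + A * x) * (X * y + A * x)) + X * X * (x * x) + d * (A * A) * (d * (y * y))
  mid = solve-∀

-- The period 1, a - 2, 1, 2ab - 2 and its parameters.

module Period {a b c d e m X : ℕ}
  -- The differences ab - 1, a - 2, a²b - 1 and a²b² - 2b enter as variables tied by equations
  -- without subtraction, so that identities over the semiring ℕ and cancellation suffice.
  (e+2≡a : 2 + e ≡ a) (c+1≡ab : 1 + c ≡ a * b) (m≡2c : m ≡ c + c)
  (X+1≡a²b : 1 + X ≡ a * a * b) (d+2b≡a²b² : d + 2 * b ≡ a * b * (a * b))
  (0<b : 0 < b) (0<c : 0 < c) (0<e : 0 < e) where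

  private
    0<a : 0 < a
    0<a = subst (0 <_) e+2≡a (s≤s z≤n)
    0<m : 0 < m
    0<m = subst (0 <_) (sym m≡2c) (<-≤-trans 0<c (m≤m+n c c))

  block : Vec ℕ 4
  block = 1 Vec.∷ e Vec.∷ 1 Vec.∷ m Vec.∷ Vec.[]

  block>0 : ∀ j → 0 < lookup block j
  block>0 Fin.zero                               = s≤s z≤n
  block>0 (Fin.suc Fin.zero)                     = 0<e
  block>0 (Fin.suc (Fin.suc Fin.zero))           = s≤s z≤n
  block>0 (Fin.suc (Fin.suc (Fin.suc Fin.zero))) = 0<m

  -- The fundamental solution.

  pell : X * X ≡ 1 + d * (a * a)
  -- Adding 1 + 2X completes the square: (1 + X)² = (a²b)² = a²(d + 2b) = da² + 2(1 + X).
  pell = +-cancelʳ-≡ (1 + X + X) _ _ (begin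
    X * X + (1 + X + X)                 ≡⟨ square-suc X ⟩
    (1 + X) * (1 + X)                   ≡⟨ cong₂ _*_ X+1≡a²b X+1≡a²b ⟩
    a * a * b * (a * a * b)             ≡⟨ regroup a b ⟩
    a * b * (a * b) * (a * a)           ≡⟨ cong (_* (a * a)) d+2b≡a²b² ⟨
    (d + 2 * b) * (a * a)               ≡⟨ expand d b a ⟩
    d * (a * a) + 2 * (a * a * b)       ≡⟨ cong (λ z → d * (a * a) + 2 * z) X+1≡a²b ⟨
    d * (a * a) + 2 * (1 + X)           ≡⟨ split (d * (a * a)) X ⟩
    1 + d * (a * a) + (1 + X + X)       ∎)
    where
    open ≡-Reasoning
    square-suc : ∀ X → X * X + (1 + X + X) ≡ (1 + X) * (1 + X)
    square-suc = solve-∀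
    regroup : ∀ a b → a * a * b * (a * a * b) ≡ a * b * (a * b) * (a * a)
    regroup = solve-∀
    expand : ∀ d b a → (d + 2 * b) * (a * a) ≡ d * (a * a) + 2 * (a * a * b)
    expand = solve-∀
    split : ∀ n X → n + 2 * (1 + X) ≡ 1 + n + (1 + X + X)
    split = solve-∀

  0<X : 0 < X
  0<X = n≢0⇒n>0 λ { refl → 0≢1+n pell }

  a-minimal : ∀ u v → 0 < v → u * u ≡ 1 + d * (v * v) → a ≤ v
  a-minimal u v 0<v eq = *-cancelʳ-≤ a v (b * v) {{ℕ.>-nonZero (*-mono-< 0<b 0<v)}} (begin
    a * (b * v)    ≡⟨ *-assoc a b v ⟨
    w              ≤⟨ *-cancelˡ-≤ 2 2w≤2bv² ⟩
    b * (v * v)    ≡⟨ rotate b v ⟩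
    v * (b * v)    ∎)
    where
    open ≤-Reasoning
    rotate : ∀ b v → b * (v * v) ≡ v * (b * v)
    rotate = solve-∀
    w w′ : ℕ
    w = a * b * v
    w′ = w ∸ 1
    w≡1+w′ : w ≡ 1 + w′
    w≡1+w′ = sym (m+[n∸m]≡n (*-mono-< (*-mono-< 0<a 0<b) 0<v))
    u²+2bv² : u * u + 2 * (b * (v * v)) ≡ 1 + w * w
    u²+2bv² = begin-equality
      u * u + 2 * (b * (v * v))               ≡⟨ cong (_+ 2 * (b * (v * v))) eq ⟩
      1 + d * (v * v) + 2 * (b * (v * v))     ≡⟨ collect d b v ⟩
      1 + (d + 2 * b) * (v * v)               ≡⟨ cong (λ z → 1 + z * (v * v)) d+2b≡a²b² ⟩
      1 + a * b * (a * b) * (v * v)           ≡⟨ regroup (a * b) v ⟩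
      1 + w * w                               ∎
      where
      collect : ∀ d b v → 1 + d * (v * v) + 2 * (b * (v * v)) ≡ 1 + (d + 2 * b) * (v * v)
      collect = solve-∀
      regroup : ∀ n v → 1 + n * n * (v * v) ≡ 1 + n * v * (n * v)
      regroup = solve-∀
    -- Since bv² ≥ 1, the left side of `u²+2bv²` is at least u² + 2, which forces u² < w².
    u<w : u < w
    u<w = square-cancel-< (≤-pred (begin
      2 + u * u                        ≡⟨ +-comm 2 (u * u) ⟩
      u * u + 2                        ≤⟨ +-monoʳ-≤ (u * u) (*-monoʳ-≤ 2 (*-mono-< 0<b (*-mono-< 0<v 0<v))) ⟩
      u * u + 2 * (b * (v * v))        ≡⟨ u²+2bv² ⟩
      1 + w * w                        ∎))
    u≤w′ : u ≤ w′
    u≤w′ = ≤-pred (subst (u <_) w≡1+w′ u<w)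
    -- As w = 1 + w′, one has 1 + w² = w′² + 2w; the bound u² ≤ w′² then lets w′² be cancelled.
    2w≤2bv² : 2 * w ≤ 2 * (b * (v * v))
    2w≤2bv² = +-cancelˡ-≤ (w′ * w′) _ _ (begin
      w′ * w′ + 2 * w                  ≡⟨ cong (λ z → w′ * w′ + 2 * z) w≡1+w′ ⟩
      w′ * w′ + 2 * (1 + w′)           ≡⟨ square-suc w′ ⟩
      1 + (1 + w′) * (1 + w′)          ≡⟨ cong (λ z → 1 + z * z) w≡1+w′ ⟨
      1 + w * w                        ≡⟨ u²+2bv² ⟨
      u * u + 2 * (b * (v * v))        ≤⟨ +-monoˡ-≤ (2 * (b * (v * v))) (*-mono-≤ u≤w′ u≤w′) ⟩
      w′ * w′ + 2 * (b * (v * v))      ∎)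
      where
      square-suc : ∀ n → n * n + 2 * (1 + n) ≡ 1 + (1 + n) * (1 + n)
      square-suc = solve-∀

  fundamental : IsFundamentalSolution d X a
  fundamental = record
    { solution = record { x>0 = 0<X ; y>0 = 0<a ; pell = pell⇐ d X a pell }
    ; smallest = λ u v s → let
        open IsPositiveSolution s renaming (pell to pell-uv)
        eq = pell⇒ d u v pell-uv
        a≤v = a-minimal u v y>0 eq
      -- The bound on the first component follows from the one on the second, because 1 + dy² is
      -- monotone in y.
      in square-cancel-≤ (subst₂ _≤_ (sym pell) (sym eq)
           (+-monoʳ-≤ 1 (*-monoʳ-≤ d (*-mono-≤ a≤v a≤v)))) , a≤v
    }

  -- `IsNthSolution` starts from some fundamental solution. Two of them bound each other in both
  -- components, so the start can only be (X, a).
  fundamental-unique : ∀ {x y} → IsFundamentalSolution d x y → (x , y) ≡ (X , a)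
  fundamental-unique {x} {y} f = cong₂ _,_ (≤-antisym (proj₁ f≤) (proj₁ ≤f)) (≤-antisym (proj₂ f≤) (proj₂ ≤f))
    where
    open IsFundamentalSolution
    f≤ : x ≤ X × y ≤ a
    f≤ = smallest f X a (solution fundamental)
    ≤f : X ≤ x × a ≤ y
    ≤f = smallest fundamental x y (solution f)

  -- One period acts as multiplication by X + a√d.

  fraction-block : ∀ {as x y} → Fraction c as x y →
    let (x′ , y′) = mul√ d (X , a) (x , y) in Fraction c (1 ∷ e ∷ 1 ∷ m ∷ as) x′ y′
  fraction-block {as} {x} {y} f = subst₂ (Fraction c _) num den
    (fraction-∷ 0<c (fraction-∷ (s≤s z≤n) (fraction-∷ 0<e (fraction-∷ (s≤s z≤n)
      (subst (λ z → Fraction z as p₀ y) (sym m≡2c) (fraction-+ c f))))))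
    where
    open ≡-Reasoning
    -- The successive numerators as m, 1, e, 1, c are prepended. Each is the denominator of the
    -- next, so the result is p₄/p₃.
    p₀ p₁ p₂ p₃ p₄ : ℕ
    p₀ = c * y + x
    p₁ = 1 * p₀ + y
    p₂ = e * p₁ + p₀
    p₃ = 1 * p₂ + p₁
    p₄ = c * p₃ + p₂

    p₁≡ : p₁ ≡ a * b * y + x
    p₁≡ = trans (lemma c x y) (cong (λ z → z * y + x) c+1≡ab)
      where
      lemma : ∀ c x y → 1 * (c * y + x) + y ≡ (1 + c) * y + x
      lemma = solve-∀

    den : p₃ ≡ X * y + a * x
    -- Since p₀ + y = p₁, adding y to p₃ = ep₁ + p₀ + p₁ gives (2 + e)p₁ = ap₁.
    den = +-cancelʳ-≡ y _ _ (begin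
      p₃ + y                          ≡⟨ lemma₁ e p₀ y ⟩
      (2 + e) * p₁                    ≡⟨ cong₂ _*_ e+2≡a p₁≡ ⟩
      a * (a * b * y + x)             ≡⟨ lemma₂ a b x y ⟩
      a * a * b * y + a * x           ≡⟨ cong (λ z → z * y + a * x) X+1≡a²b ⟨
      (1 + X) * y + a * x             ≡⟨ lemma₃ X y (a * x) ⟩
      X * y + a * x + y               ∎)
      where
      lemma₁ : ∀ e p y → 1 * (e * (1 * p + y) + p) + (1 * p + y) + y ≡ (2 + e) * (1 * p + y)
      lemma₁ = solve-∀
      lemma₂ : ∀ a b x y → a * (a * b * y + x) ≡ a * a * b * y + a * x
      lemma₂ = solve-∀
      lemma₃ : ∀ X y z → (1 + X) * y + z ≡ X * y + z + y
      lemma₃ = solve-∀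

    -- Splits the coefficient of y in the numerator into da, which is wanted, and ab, which belongs
    -- to p₁.
    abX : a * b * X ≡ d * a + a * b
    abX = +-cancelʳ-≡ (a * b) _ _ (begin
      a * b * X + a * b               ≡⟨ lemma₁ (a * b) X ⟩
      a * b * (1 + X)                 ≡⟨ cong (a * b *_) X+1≡a²b ⟩
      a * b * (a * a * b)             ≡⟨ lemma₂ a b ⟩
      a * b * (a * b) * a             ≡⟨ cong (_* a) d+2b≡a²b² ⟨
      (d + 2 * b) * a                 ≡⟨ lemma₃ a b d ⟩
      d * a + a * b + a * b           ∎)
      where
      lemma₁ : ∀ n X → n * X + n ≡ n * (1 + X)
      lemma₁ = solve-∀
      lemma₂ : ∀ a b → a * b * (a * a * b) ≡ a * b * (a * b) * a
      lemma₂ = solve-∀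
      lemma₃ : ∀ a b d → (d + 2 * b) * a ≡ d * a + a * b + a * b
      lemma₃ = solve-∀

    num : p₄ ≡ X * x + d * (a * y)
    -- Since p₂ + p₁ = p₃, adding p₁ to p₄ = cp₃ + p₂ gives (1 + c)p₃ = abp₃.
    num = +-cancelʳ-≡ p₁ _ _ (begin
      p₄ + p₁                                     ≡⟨ lemma₁ c p₁ p₂ ⟩
      (1 + c) * p₃                                ≡⟨ cong₂ _*_ c+1≡ab den ⟩
      a * b * (X * y + a * x)                     ≡⟨ lemma₂ a b X x y ⟩
      a * b * X * y + a * a * b * x               ≡⟨ cong₂ (λ z w → z * y + w * x) abX (sym X+1≡a²b) ⟩
      (d * a + a * b) * y + (1 + X) * x           ≡⟨ lemma₃ a b d X x y ⟩
      X * x + d * (a * y) + (a * b * y + x)       ≡⟨ cong (λ z → X * x + d * (a * y) + z) p₁≡ ⟨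
      X * x + d * (a * y) + p₁                    ∎)
      where
      lemma₁ : ∀ c p q → c * (1 * q + p) + q + p ≡ (1 + c) * (1 * q + p)
      lemma₁ = solve-∀
      lemma₂ : ∀ a b X x y → a * b * (X * y + a * x) ≡ a * b * X * y + a * a * b * x
      lemma₂ = solve-∀
      lemma₃ : ∀ a b d X x y → (d * a + a * b) * y + (1 + X) * x ≡ X * x + d * (a * y) + (a * b * y + x)
      lemma₃ = solve-∀

  -- Convergence of the periodic continued fraction to √d.

  period : ℕ → List ℕ
  period = applyUpTo (λ i → periodic c block (suc i))

  -- The last two fields together say |x² - dy²| ≤ B. Keeping `B` apart from `k` lets each period
  -- raise the bound on the denominator at no cost in `B`.
  record Approximant (B k n : ℕ) : Set where
    constructor approximant
    field
      x y  : ℕ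
      frac : Fraction c (period n) x y
      k<y  : k < y
      x²≤  : x * x ≤ d * (y * y) + B
      dy²≤ : d * (y * y) ≤ x * x + B

  -- The norm is unchanged, so `B` persists, while y′ = Xy + ax > y because X ≥ 1 and ax > 0.
  approximant-step : ∀ {B k n} → Approximant B k n → Approximant B (suc k) (4 + n)
  -- `fraction-block` fits without transport: (4 + i) mod 4 computes to i mod 4, so `period (4 + n)`
  -- unfolds to one block followed by `period n`.
  approximant-step {B} {k} (approximant x y f k<y x²≤ dy²≤) = approximant x′ y′ (fraction-block f)
    (begin-strict
        suc k           ≤⟨ k<y ⟩
        y               ≤⟨ m≤n*m y X {{ℕ.>-nonZero 0<X}} ⟩
        X * y           <⟨ m<m+n (X * y) (*-mono-< 0<a x>0) ⟩
        X * y + a * x   ∎)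
    (+-cancelʳ-≤ (d * (y * y)) _ _ (begin
        x′ * x′ + d * (y * y)                  ≡⟨ norm ⟩
        d * (y′ * y′) + x * x                  ≤⟨ +-monoʳ-≤ (d * (y′ * y′)) x²≤ ⟩
        d * (y′ * y′) + (d * (y * y) + B)      ≡⟨ swap (d * (y′ * y′)) (d * (y * y)) B ⟩
        d * (y′ * y′) + B + d * (y * y)        ∎))
    (+-cancelʳ-≤ (x * x) _ _ (begin
        d * (y′ * y′) + x * x                  ≡⟨ norm ⟨
        x′ * x′ + d * (y * y)                  ≤⟨ +-monoʳ-≤ (x′ * x′) dy²≤ ⟩
        x′ * x′ + (x * x + B)                  ≡⟨ swap (x′ * x′) (x * x) B ⟩
        x′ * x′ + B + x * x                    ∎))
    where
    open ≤-Reasoning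
    open Fraction f
    x′ y′ : ℕ
    x′ = proj₁ (mul√ d (X , a) (x , y))
    y′ = proj₂ (mul√ d (X , a) (x , y))
    norm : x′ * x′ + d * (y * y) ≡ d * (y′ * y′) + x * x
    norm = mul√-norm d X a x y pell
    swap : ∀ p q r → p + (q + r) ≡ p + r + q
    swap = solve-∀

  approximant-weaken : ∀ {B B′ k k′ n} → B ≤ B′ → k′ ≤ k → Approximant B k n → Approximant B′ k′ n
  approximant-weaken B≤B′ k′≤k (approximant x y f k<y x²≤ dy²≤) =
    approximant x y f (≤-<-trans k′≤k k<y)
      (≤-trans x²≤ (+-monoʳ-≤ (d * (y * y)) B≤B′)) (≤-trans dy²≤ (+-monoʳ-≤ (x * x) B≤B′))

  -- Here B may depend on n, and x² + dy² is a crude bound for |x² - dy²|. The cases n < 4 start the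
  -- induction in `bound`.
  approximant-exists : ∀ n → ∃[ B ] Approximant B 0 n
  approximant-exists n =
    let (x , y , f) = cf-fraction 0<c (applyUpTo⁺₂ _ n (λ i → block>0 (i mod 4)))
    in  x * x + d * (y * y) , approximant x y f (Fraction.y>0 f)
          (≤-trans (m≤m+n (x * x) (d * (y * y))) (m≤n+m _ (d * (y * y))))
          (≤-trans (m≤n+m _ (x * x)) (m≤n+m _ (x * x)))

  -- Every n is reached from its residue mod 4 by whole periods, which preserve the norm; hence the
  -- sum of the four initial bounds serves for all n.
  bound : ∃[ B ] (∀ k n → k * 4 ≤ n → Approximant B k n)
  bound = B , λ k n → go k n
    where
    b₀ b₁ b₂ b₃ B : ℕ
    b₀ = proj₁ (approximant-exists 0)
    b₁ = proj₁ (approximant-exists 1)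
    b₂ = proj₁ (approximant-exists 2)
    b₃ = proj₁ (approximant-exists 3)
    B = b₀ + b₁ + (b₂ + b₃)
    go : ∀ k n → k * 4 ≤ n → Approximant B k n
    go (suc k) (suc (suc (suc (suc n)))) (s≤s (s≤s (s≤s (s≤s h)))) = approximant-step (go k n h)
    -- Periods beyond the k requested ones are still stripped, and the gain in the denominator is
    -- forgotten.
    go zero    (suc (suc (suc (suc n)))) _ = approximant-weaken ≤-refl z≤n (approximant-step (go zero n z≤n))
    go zero 0 _ = approximant-weaken (≤-trans (m≤m+n b₀ b₁) (m≤m+n _ (b₂ + b₃))) z≤n (proj₂ (approximant-exists 0))
    go zero 1 _ = approximant-weaken (≤-trans (m≤n+m b₁ b₀) (m≤m+n _ (b₂ + b₃))) z≤n (proj₂ (approximant-exists 1))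
    go zero 2 _ = approximant-weaken (≤-trans (m≤m+n b₂ b₃) (m≤n+m _ (b₀ + b₁))) z≤n (proj₂ (approximant-exists 2))
    go zero 3 _ = approximant-weaken (≤-trans (m≤n+m b₃ b₂) (m≤n+m _ (b₀ + b₁))) z≤n (proj₂ (approximant-exists 3))

  infiniteCF : IsInfiniteCF (√ d) (periodic c block)
  infiniteCF = record
    { quotients>0 = λ i → block>0 (i mod 4)
    ; value = λ ε 0<ε → let
          (B , approx) = bound
          (k , B<) = archimedean B ε 0<ε
        -- From 4k quotients on, the denominator y is at least k + 1, so B/y ≤ B/(k + 1) < ε.
        in k * 4 , λ n k4≤n → let (approximant x y f k<y x²≤ dy²≤) = approx k n k4≤n
                              in fraction-approx d B k f k<y x²≤ dy²≤ 0<ε B<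
    }

  -- The n-th solution as a finite continued fraction.

  quotients : ℕ → List ℕ
  -- The tail is a block without its final 2c. With a lone 1 as tail, the case without blocks would
  -- be [c; 1] = ab instead of X/a = (a²b - 1)/a.
  quotients n = concat (replicate n (toList block)) ++ 1 ∷ e ∷ 1 ∷ []

  quotients-pos : ∀ n → All (0 <_) (quotients n)
  quotients-pos zero    = s≤s z≤n ∷ 0<e ∷ s≤s z≤n ∷ []
  quotients-pos (suc n) = s≤s z≤n ∷ 0<e ∷ s≤s z≤n ∷ 0<m ∷ quotients-pos n

  power-fraction : ∀ n → let (x , y) = pow√ d (X , a) (suc n) in Fraction c (quotients n) x y
  power-fraction (suc n) = fraction-block (power-fraction n)
  -- For [c; 1, e, 1] the numerators from the right are 1, e + 1, e + 2 = a and ca + e + 1, the last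
  -- being one less than (1 + c)a = a²b.
  power-fraction zero = subst₂ (Fraction c _) num den
    (fraction-∷ 0<c (fraction-∷ (s≤s z≤n) (fraction-∷ 0<e (fraction-[] (s≤s z≤n)))))
    where
    open ≡-Reasoning
    p : ℕ
    p = e * 1 + 1
    den : 1 * p + 1 ≡ X * 0 + a * 1
    den = trans (lemma e) (trans e+2≡a (lemma′ X a))
      where
      lemma : ∀ e → 1 * (e * 1 + 1) + 1 ≡ 2 + e
      lemma = solve-∀
      lemma′ : ∀ X a → a ≡ X * 0 + a * 1
      lemma′ = solve-∀
    num : c * (1 * p + 1) + p ≡ X * 1 + d * (a * 0)
    num = +-cancelʳ-≡ 1 _ _ (begin
      c * (1 * p + 1) + p + 1      ≡⟨ lemma₁ c e ⟩
      (1 + c) * (2 + e)            ≡⟨ cong₂ _*_ c+1≡ab e+2≡a ⟩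
      a * b * a                    ≡⟨ lemma₂ a b ⟩
      a * a * b                    ≡⟨ X+1≡a²b ⟨
      1 + X                        ≡⟨ lemma₃ X a d ⟩
      X * 1 + d * (a * 0) + 1      ∎)
      where
      lemma₁ : ∀ c e → c * (1 * (e * 1 + 1) + 1) + (e * 1 + 1) + 1 ≡ (1 + c) * (2 + e)
      lemma₁ = solve-∀
      lemma₂ : ∀ a b → a * b * a ≡ a * a * b
      lemma₂ = solve-∀
      lemma₃ : ∀ X a d → 1 + X ≡ X * 1 + d * (a * 0) + 1
      lemma₃ = solve-∀

  nth-solution : (n x y : ℕ) → 1 ≤ n → IsNthSolution d n x y →
    Σ[ y≢0 ∈ NonZero y ] IsFiniteCF (_/_ (+ x) y {{y≢0}}) c (quotients (n ∸ 1))
  nth-solution (suc n) x y _ (x₁ , y₁ , f , xy≡) = y≢0 , record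
    { quotients>0 = quotients-pos n
    ; value = fraction-/ frac {{y≢0}}
    }
    where
    xy≡pow : (x , y) ≡ pow√ d (X , a) (suc n)
    xy≡pow = trans xy≡ (cong (λ z → pow√ d z (suc n)) (fundamental-unique f))
    frac : Fraction c (quotients n) x y
    frac = subst₂ (Fraction c (quotients n)) (sym (cong proj₁ xy≡pow)) (sym (cong proj₂ xy≡pow))
      (power-fraction n)
    y≢0 : NonZero y
    y≢0 = ℕ.>-nonZero (Fraction.y>0 frac)

-- Specialisation to a ≥ 3 and b ≥ 1, where the truncated subtractions are exact.

theorem9 : (a b : ℕ) → 3 ≤ a → 1 ≤ b →
    let d     = a ^ 2 * b ^ 2 ∸ 2 * b
        block = 1 Vec.∷ (a ∸ 2) Vec.∷ 1 Vec.∷ (2 * a * b ∸ 2) Vec.∷ Vec.[]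
    in IsInfiniteCF (√ d) (periodic (a * b ∸ 1) block)
       × IsFundamentalSolution d (a ^ 2 * b ∸ 1) a
       × ((n x y : ℕ) → 1 ≤ n → IsNthSolution d n x y →
            Σ[ y≢0 ∈ NonZero y ]
              IsFiniteCF (_/_ (+ x) y {{y≢0}}) (a * b ∸ 1)
                (concat (replicate (n ∸ 1) (toList block)) ++ 1 ∷ (a ∸ 2) ∷ 1 ∷ []))
theorem9 a b 3≤a 1≤b = infiniteCF , fundamental , nth-solution
  where
  c d X : ℕ
  c = a * b ∸ 1
  d = a ^ 2 * b ^ 2 ∸ 2 * b
  X = a ^ 2 * b ∸ 1

  3≤ab : 3 ≤ a * b
  3≤ab = *-mono-≤ 3≤a 1≤b

  c+1≡ab : 1 + c ≡ a * b
  c+1≡ab = m+[n∸m]≡n (≤-trans (s≤s z≤n) 3≤ab)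

  m≡2c : 2 * a * b ∸ 2 ≡ c + c
  m≡2c = cong (_∸ 2) (trans (*-assoc 2 a b) (trans (cong (2 *_) (sym c+1≡ab)) (lemma c)))
    where
    lemma : ∀ c → 2 * (1 + c) ≡ 2 + (c + c)
    lemma = solve-∀

  X+1≡a²b : 1 + X ≡ a * a * b
  X+1≡a²b = trans (m+[n∸m]≡n (*-mono-≤ (*-mono-≤ 1≤a (*-mono-≤ 1≤a ≤-refl)) 1≤b)) (lemma a b)
    where
    1≤a : 1 ≤ a
    1≤a = ≤-trans (s≤s z≤n) 3≤a
    lemma : ∀ a b → a * (a * 1) * b ≡ a * a * b
    lemma = solve-∀

  d+2b≡a²b² : d + 2 * b ≡ a * b * (a * b)
  d+2b≡a²b² = trans (m∸n+n≡m (subst (2 * b ≤_) (sym a²b²≡) 2b≤a²b²)) a²b²≡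
    where
    lemma : ∀ a b → a * (a * 1) * (b * (b * 1)) ≡ a * b * (a * b)
    lemma = solve-∀
    a²b²≡ : a ^ 2 * b ^ 2 ≡ a * b * (a * b)
    a²b²≡ = lemma a b
    -- Through 2b ≤ ab ≤ (ab)².
    2b≤a²b² : 2 * b ≤ a * b * (a * b)
    2b≤a²b² = ≤-trans (*-monoˡ-≤ b (≤-trans (s≤s (s≤s z≤n)) 3≤a))
      (m≤m*n (a * b) (a * b) {{ℕ.>-nonZero (≤-trans (s≤s z≤n) 3≤ab)}})

  -- Spelled out without the abbreviations c, d, X: otherwise comparing √ d with the
  -- goal unfolds the Dedekind cuts, which is very slow.
  open Period
    {a} {b} {a * b ∸ 1} {a ^ 2 * b ^ 2 ∸ 2 * b} {a ∸ 2} {2 * a * b ∸ 2} {a ^ 2 * b ∸ 1}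
    (m+[n∸m]≡n (≤-trans (s≤s (s≤s z≤n)) 3≤a))
    c+1≡ab m≡2c X+1≡a²b d+2b≡a²b² 1≤b
    -- The bound a ≥ 3 makes the partial quotient a - 2 positive.
    (∸-monoˡ-≤ 1 (≤-trans (s≤s (s≤s z≤n)) 3≤ab)) (∸-monoˡ-≤ 2 3≤a)
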